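{- For all finite sets of formulas $\Gamma,\Delta$: $\Gamma\Vdash\Delta$ if and only if $\Gamma\Vdash_{\mathcal{ST}}\Delta$.
   Context: Fix a countably infinite set $\mathsf{At}$ of atoms. Formulas are built from atoms and the constant $\bot$ using the binary connectives $\land,\lor,\to$. All contexts ($\Gamma,\Delta,\Theta,\Sigma,\dots$) are finite sets (not multisets) of formulas; a comma denotes union; a subscript $\mathsf{At}$ indicates a finite set of atoms. An atomic sequent has the form $\Gamma_{\mathsf{At}} \Rightarrow \Delta_{\mathsf{At}}$. An atomic rule has finitely many (possibly zero) atomic sequents as premises and one atomic sequent as conclusion; a rule with zero premises is an atomic axiom. A base is a (possibly empty) set of atomic rules; $\mathcal{C}\supseteq\mathcal{B}$ ($\mathcal{C}$ extends $\mathcal{B}$) if $\mathcal{C}$ contains every rule of $\mathcal{B}$. Derivability $\vdash_{\mathcal{B}}$ of atomic sequents is the least relation such that: (Axiom/Weakening) if an atomic axiom with conclusion $\Gamma_{\mathsf{At}}\Rightarrow\Delta_{\mathsf{At}}$ is in $\mathcal{B}$, then $\vdash_{\mathcal{B}} \Theta_{\mathsf{At}},\Gamma_{\mathsf{At}}\Rightarrow\Delta_{\mathsf{At}},\Sigma_{\mathsf{At}}$ for all sets of atoms $\Theta_{\mathsf{At}},\Sigma_{\mathsf{At}}$; (Mix) if a rule with premises $\Gamma^i_{\mathsf{At}}\Rightarrow\Delta^i_{\mathsf{At}}$ ($1\le i\le n$) and conclusion $\Gamma_{\mathsf{At}}\Rightarrow\Delta_{\mathsf{At}}$ is in $\mathcal{B}$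 and $\vdash_{\mathcal{B}} \Theta^i_{\mathsf{At}},\Gamma^i_{\mathsf{At}}\Rightarrow\Delta^i_{\mathsf{At}},\Sigma^i_{\mathsf{At}}$ for each $i$, then $\vdash_{\mathcal{B}} \Theta^1_{\mathsf{At}},\dots,\Theta^n_{\mathsf{At}},\Gamma_{\mathsf{At}}\Rightarrow\Delta_{\mathsf{At}},\Sigma^1_{\mathsf{At}},\dots,\Sigma^n_{\mathsf{At}}$. Support $\Vdash_{\mathcal{B}}$: (At) $\Vdash_{\mathcal{B}}\Gamma_{\mathsf{At}}$ iff $\vdash_{\mathcal{B}}\ \Rightarrow\Gamma_{\mathsf{At}}$; ($\land$) $\Vdash_{\mathcal{B}} A\land B,\Gamma$ iff $\Vdash_{\mathcal{B}}A,\Gamma$ and $\Vdash_{\mathcal{B}}B,\Gamma$; ($\lor$) $\Vdash_{\mathcal{B}}A\lor B,\Gamma$ iff $\Vdash_{\mathcal{B}}A,B,\Gamma$; ($\to$) $\Vdash_{\mathcal{B}}A\to B,\Gamma$ iff $A\Vdash_{\mathcal{B}}B,\Gamma$; ($\bot$) $\Vdash_{\mathcal{B}}\bot,\Gamma$ iff $\Vdash_{\mathcal{B}}\Gamma$; (Inf) for $n\ge1$, $\{A^1,\dots,A^n\}\Vdash_{\mathcal{B}}\Delta$ iff for every $\mathcal{C}\supseteq\mathcal{B}$ and all sets of atoms $\Theta^1_{\mathsf{At}},\dots,\Theta^n_{\mathsf{At}}$, if $\Vdash_{\mathcal{C}}\Theta^i_{\mathsf{At}},A^i$ for all $i$ then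 $\Vdash_{\mathcal{C}}\Theta^1_{\mathsf{At}},\dots,\Theta^n_{\mathsf{At}},\Delta$ (and $\varnothing\Vdash_{\mathcal{B}}\Delta$ means $\Vdash_{\mathcal{B}}\Delta$). The atomic identity rule $\mathsf{Ainit}$ is the atomic axiom $\Gamma_{\mathsf{At}},p\Rightarrow p,\Delta_{\mathsf{At}}$; the atomic cut rule $\mathsf{Acut}$ has premises $\Gamma^1_{\mathsf{At}}\Rightarrow\Delta^1_{\mathsf{At}},p$ and $p,\Gamma^2_{\mathsf{At}}\Rightarrow\Delta^2_{\mathsf{At}}$ and conclusion $\Gamma^1_{\mathsf{At}},\Gamma^2_{\mathsf{At}}\Rightarrow\Delta^1_{\mathsf{At}},\Delta^2_{\mathsf{At}}$. $\mathcal{ST}$ is the base consisting of all instances of $\mathsf{Ainit}$ and $\mathsf{Acut}$ (all atoms $p$, all sets of atoms). Validity: $\Gamma\Vdash\Delta$ iff $\Gamma\Vdash_{\mathcal{B}}\Delta$ for every base $\mathcal{B}\supseteq\mathcal{ST}$. -}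

module Defs where

open import Level using (Level; 0ℓ; Lift; lift; lower) renaming (suc to lsuc)
open import Data.Fin.Base using (Fin; zero; suc)
open import Data.List.Base using (List; []; _∷_; _++_; map; concat; foldr; length; lookup; tabulate)
open import Data.List.Membership.Propositional using (_∈_)
open import Data.List.Membership.Propositional.Properties using (∈-++⁻)
open import Data.List.Relation.Binary.Pointwise.Base using (Pointwise)
import Data.List.Relation.Binary.Pointwise as PW
open import Data.List.Relation.Binary.Subset.Propositional using (_⊆_)
open import Data.List.Relation.Binary.Subset.Propositional.Properties using (xs⊆xs++ys; xs⊆ys++xs; ++⁺ˡ; ++⁺ʳ; ∷⁺ʳ; xs⊆x∷xs)
open import Data.List.Relation.Unary.Any using (here; there)
open import Data.Nat.Base using (ℕ)
open import Data.Product.Base using (_×_; _,_; proj₁; proj₂; ∃-syntax)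
open import Data.Sum.Base using (_⊎_; inj₁; inj₂; [_,_]′)
open import Function.Base using (id; _∘_)
open import Function.Bundles using (_⇔_; mk⇔; Equivalence)
open import Relation.Binary.PropositionalEquality using (_≡_; refl; sym; subst)

-- A finite set is a list, considered up to _≈_ (same elements): order and
-- repetitions are irrelevant.

FinSet : Set → Set
FinSet = List

infix 4 _≈_
_≈_ : {A : Set} → FinSet A → FinSet A → Set
X ≈ Y = (X ⊆ Y) × (Y ⊆ X)

infixr 5 _∪_
_∪_ : {A : Set} → FinSet A → FinSet A → FinSet A
_∪_ = _++_

⋃ : {A : Set} {n : ℕ} → (Fin n → FinSet A) → FinSet A
⋃ X = concat (tabulate X)

At : Set
At = ℕ

infixr 8 _∧_
infixr 7 _∨_
infixr 6 _⟶_

data Formula : Set where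
  atom        : At → Formula
  ⊥           : Formula
  _∧_ _∨_ _⟶_ : Formula → Formula → Formula

Atoms : Set
Atoms = FinSet At

Formulas : Set
Formulas = FinSet Formula

atoms : Atoms → Formulas
atoms = map atom

infix 4 _⇒_
record Sequent : Set where
  constructor _⇒_
  field
    ante : Atoms
    succ : Atoms
open Sequent public

infix 4 _≈ˢ_
_≈ˢ_ : Sequent → Sequent → Set
(Γ ⇒ Δ) ≈ˢ (Γ′ ⇒ Δ′) = (Γ ≈ Γ′) × (Δ ≈ Δ′)

infix 3 _/_
record Rule : Set where
  constructor _/_
  field
    premises   : List Sequent
    conclusion : Sequent
open Rule public

infix 4 _≈ʳ_
_≈ʳ_ : Rule → Rule → Set
(Ss / S) ≈ʳ (Ts / T) = Pointwise _≈ˢ_ Ss Ts × (S ≈ˢ T)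

-- A base is an arbitrary set of rules; `resp` says that membership does not
-- depend on which lists represent the finite sets occurring in a rule.

record Base : Set₁ where
  field
    Has  : Rule → Set
    resp : ∀ {R R′} → R ≈ʳ R′ → Has R → Has R′
open Base public

infix 4 _⊇_
_⊇_ : Base → Base → Set
𝒞 ⊇ ℬ = ∀ {R} → Has ℬ R → Has 𝒞 R

infix 3 _⊢_
data _⊢_ (ℬ : Base) : Sequent → Set where
  axiom : ∀ {Γ Δ} → Has ℬ ([] / Γ ⇒ Δ) →
          (Θ Σ : Atoms) → ℬ ⊢ Θ ∪ Γ ⇒ Δ ∪ Σ
  mix   : ∀ {Ss Γ Δ} → Has ℬ (Ss / Γ ⇒ Δ) →
          (Θ Σ : Fin (length Ss) → Atoms) →
          (∀ i → ℬ ⊢ Θ i ∪ ante (lookup Ss i) ⇒ succ (lookup Ss i) ∪ Σ i) →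
          ℬ ⊢ ⋃ Θ ∪ Γ ⇒ Δ ∪ ⋃ Σ
  -- derivability is a property of sequents of sets
  cong  : ∀ {S T} → S ≈ˢ T → ℬ ⊢ S → ℬ ⊢ T

-- The defining clauses of support.  The left-hand set in `Inf` is
-- {A¹,…,Aⁿ} with n ≥ 1; `[] ⊩⟨ ℬ ⟩ Δ` is ⊩_ℬ Δ.

record SupportClauses (_⊩⟨_⟩_ : Formulas → Base → Formulas → Set₁) : Set₁ where
  field
    cong-⊩ : ∀ {ℬ Γ Γ′ Δ Δ′} → Γ ≈ Γ′ → Δ ≈ Δ′ → Γ ⊩⟨ ℬ ⟩ Δ → Γ′ ⊩⟨ ℬ ⟩ Δ′
    ⊩At    : ∀ ℬ Γ → ([] ⊩⟨ ℬ ⟩ atoms Γ) ⇔ (ℬ ⊢ [] ⇒ Γ)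
    ⊩∧     : ∀ ℬ A B Γ → ([] ⊩⟨ ℬ ⟩ (A ∧ B ∷ Γ)) ⇔ (([] ⊩⟨ ℬ ⟩ (A ∷ Γ)) × ([] ⊩⟨ ℬ ⟩ (B ∷ Γ)))
    ⊩∨     : ∀ ℬ A B Γ → ([] ⊩⟨ ℬ ⟩ (A ∨ B ∷ Γ)) ⇔ ([] ⊩⟨ ℬ ⟩ (A ∷ B ∷ Γ))
    ⊩⟶     : ∀ ℬ A B Γ → ([] ⊩⟨ ℬ ⟩ ((A ⟶ B) ∷ Γ)) ⇔ ((A ∷ []) ⊩⟨ ℬ ⟩ (B ∷ Γ))
    ⊩⊥     : ∀ ℬ Γ → ([] ⊩⟨ ℬ ⟩ (⊥ ∷ Γ)) ⇔ ([] ⊩⟨ ℬ ⟩ Γ)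
    Inf    : ∀ ℬ A As Δ → let Γ = A ∷ As in
             (Γ ⊩⟨ ℬ ⟩ Δ) ⇔
             (∀ 𝒞 → 𝒞 ⊇ ℬ → (Θ : Fin (length Γ) → Atoms) →
               (∀ i → [] ⊩⟨ 𝒞 ⟩ (atoms (Θ i) ∪ (lookup Γ i ∷ []))) →
               [] ⊩⟨ 𝒞 ⟩ (atoms (⋃ Θ) ∪ Δ))

-- The clauses do not form a structural recursion on Δ, so support is defined
-- as follows: `supp Δ ℬ Θ` is ⊩_ℬ Θ , Δ with the atoms met so far collected in
-- Θ, and `step A K` is what the clause for A prescribes for A , Δ, where K is
-- the meaning of Δ.  That the relation _⊩[_]_ obtained in this way satisfies
-- the clauses, and is the only one to do so, is proved below
-- (`supportClauses` and `support-unique`).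

Meaning : Set₂
Meaning = Base → Atoms → Set₁

derivable : Meaning
derivable ℬ Θ = Lift (lsuc 0ℓ) (ℬ ⊢ [] ⇒ Θ)

step : Formula → Meaning → Meaning
step (atom p) K ℬ Θ = K ℬ (p ∷ Θ)
step ⊥        K ℬ Θ = K ℬ Θ
step (A ∧ B)  K ℬ Θ = step A K ℬ Θ × step B K ℬ Θ
step (A ∨ B)  K ℬ Θ = step A (step B K) ℬ Θ
step (A ⟶ B)  K ℬ Θ = ∀ 𝒞 → 𝒞 ⊇ ℬ → (Θ′ : Atoms) → step A derivable 𝒞 Θ′ → step B K 𝒞 (Θ′ ∪ Θ)

supp : Formulas → Meaning
supp = foldr step derivable

infix 3 ⊩[_]_ _⊩[_]_ _⊩_

⊩[_]_ : Base → Formulas → Set₁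
⊩[ ℬ ] Δ = supp Δ ℬ []

_⊩[_]_ : Formulas → Base → Formulas → Set₁
[]        ⊩[ ℬ ] Δ = ⊩[ ℬ ] Δ
Γ@(_ ∷ _) ⊩[ ℬ ] Δ =
  ∀ 𝒞 → 𝒞 ⊇ ℬ → (Θ : Fin (length Γ) → Atoms) →
  (∀ i → ⊩[ 𝒞 ] atoms (Θ i) ∪ (lookup Γ i ∷ [])) →
  ⊩[ 𝒞 ] atoms (⋃ Θ) ∪ Δ

≈-refl : ∀ {A} {X : FinSet A} → X ≈ X
≈-refl = id , id

≈-sym : ∀ {A} {X Y : FinSet A} → X ≈ Y → Y ≈ X
≈-sym (f , g) = g , f

≈-trans : ∀ {A} {X Y Z : FinSet A} → X ≈ Y → Y ≈ Z → X ≈ Z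
≈-trans (f , f′) (g , g′) = (λ x → g (f x)) , (λ x → f′ (g′ x))

≈ˢ-sym : ∀ {S T} → S ≈ˢ T → T ≈ˢ S
≈ˢ-sym (e , f) = ≈-sym e , ≈-sym f

≈ˢ-trans : ∀ {S T U} → S ≈ˢ T → T ≈ˢ U → S ≈ˢ U
≈ˢ-trans (e , f) (e′ , f′) = ≈-trans e e′ , ≈-trans f f′

≈ʳ-sym : ∀ {R R′} → R ≈ʳ R′ → R′ ≈ʳ R
≈ʳ-sym (ps , c) = PW.symmetric (λ {S} {T} → ≈ˢ-sym {S} {T}) ps , ≈-sym (proj₁ c) , ≈-sym (proj₂ c)

≈ʳ-trans : ∀ {R R′ R″} → R ≈ʳ R′ → R′ ≈ʳ R″ → R ≈ʳ R″
≈ʳ-trans (ps , c) (ps′ , c′) =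
  PW.transitive (λ {S} {T} {U} → ≈ˢ-trans {S} {T} {U}) ps ps′ ,
  ≈-trans (proj₁ c) (proj₁ c′) , ≈-trans (proj₂ c) (proj₂ c′)

Ainit : Atoms → At → Atoms → Rule
Ainit Γ p Δ = [] / Γ ∪ (p ∷ []) ⇒ (p ∷ []) ∪ Δ

Acut : (Γ₁ Δ₁ : Atoms) → At → (Γ₂ Δ₂ : Atoms) → Rule
Acut Γ₁ Δ₁ p Γ₂ Δ₂ =
  (Γ₁ ⇒ Δ₁ ∪ (p ∷ [])) ∷ ((p ∷ []) ∪ Γ₂ ⇒ Δ₂) ∷ [] / Γ₁ ∪ Γ₂ ⇒ Δ₁ ∪ Δ₂

IsAinit IsAcut : Rule → Set
IsAinit R = ∃[ Γ ] ∃[ p ] ∃[ Δ ] R ≈ʳ Ainit Γ p Δ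
IsAcut  R = ∃[ Γ₁ ] ∃[ Δ₁ ] ∃[ p ] ∃[ Γ₂ ] ∃[ Δ₂ ] R ≈ʳ Acut Γ₁ Δ₁ p Γ₂ Δ₂

𝒮𝒯 : Base
𝒮𝒯 .Has R = IsAinit R ⊎ IsAcut R
𝒮𝒯 .resp e (inj₁ (Γ , p , Δ , e′)) = inj₁ (Γ , p , Δ , ≈ʳ-trans (≈ʳ-sym e) e′)
𝒮𝒯 .resp e (inj₂ (Γ₁ , Δ₁ , p , Γ₂ , Δ₂ , e′)) = inj₂ (Γ₁ , Δ₁ , p , Γ₂ , Δ₂ , ≈ʳ-trans (≈ʳ-sym e) e′)

_⊩_ : Formulas → Formulas → Set₁
Γ ⊩ Δ = ∀ ℬ → ℬ ⊇ 𝒮𝒯 → Γ ⊩[ ℬ ] Δ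

private
  variable
    ℬ 𝒞 : Base

  ∪-least : {A : Set} {X Y Z : FinSet A} → X ⊆ Z → Y ⊆ Z → X ∪ Y ⊆ Z
  ∪-least {X = X} f g m = [ f , g ]′ (∈-++⁻ X m)

  inl : {A : Set} {X Y : FinSet A} → X ⊆ X ∪ Y
  inl {X = X} {Y} = xs⊆xs++ys X Y

  inr : {A : Set} {X Y : FinSet A} → Y ⊆ X ∪ Y
  inr {X = X} {Y} = xs⊆ys++xs Y X

  ⊆-swap : {A : Set} (X Y {Z} : FinSet A) → X ∪ Y ∪ Z ⊆ Y ∪ X ∪ Z
  ⊆-swap X Y {Z} = ∪-least {X = X} (inr {X = Y} ∘ inl {X = X})
    (∪-least {X = Y} (inl {X = Y}) (inr {X = Y} ∘ inr {X = X}))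

  add : ∀ {Γ Δ} → ℬ ⊢ Γ ⇒ Δ → (Θ Σ : Atoms) → ℬ ⊢ Θ ∪ Γ ⇒ Δ ∪ Σ
  add (axiom {Γ} {Δ} r Θ₀ Σ₀) Θ Σ =
    cong ((∪-least {X = Θ ∪ Θ₀} (∪-least {X = Θ} (inl {X = Θ}) (inr {X = Θ} ∘ inl {X = Θ₀})) (inr {X = Θ} ∘ inr {X = Θ₀})
         , ∪-least {X = Θ} (inl {X = Θ ∪ Θ₀} ∘ inl {X = Θ})
             (∪-least {X = Θ₀} (inl {X = Θ ∪ Θ₀} ∘ inr {X = Θ}) (inr {X = Θ ∪ Θ₀})))
         ,(∪-least {X = Δ} (inl {X = Δ ∪ Σ₀} ∘ inl {X = Δ})
             (∪-least {X = Σ₀} (inl {X = Δ ∪ Σ₀} ∘ inr {X = Δ}) (inr {X = Δ ∪ Σ₀}))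
         , ∪-least {X = Δ ∪ Σ₀} (∪-least {X = Δ} (inl {X = Δ}) (inr {X = Δ} ∘ inl {X = Σ₀})) (inr {X = Δ} ∘ inr {X = Σ₀})))
      (axiom r (Θ ∪ Θ₀) (Σ₀ ∪ Σ))
  add (mix {[]} {Γ} {Δ} r Θ₀ Σ₀ ds) Θ Σ =
    cong (≈-refl , (++⁺ˡ Σ (inl {X = Δ}) , ++⁺ˡ Σ (∪-least {X = Δ} id λ ()))) (axiom r Θ Σ)
  add {ℬ} (mix {S ∷ Ss} {Γ} {Δ} r Θ₀ Σ₀ ds) Θ Σ =
    cong (( ∪-least {X = (Θ ∪ Θ₀ zero) ∪ ΘR}
              (∪-least {X = Θ ∪ Θ₀ zero}
                (∪-least {X = Θ} inl (inr {X = Θ} ∘ inl {X = Θ₀ zero ∪ ΘR} ∘ inl {X = Θ₀ zero}))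
                (inr {X = Θ} ∘ inl {X = Θ₀ zero ∪ ΘR} ∘ inr {X = Θ₀ zero}))
              (inr {X = Θ} ∘ inr {X = Θ₀ zero ∪ ΘR})
          , ∪-least {X = Θ} (inl {X = (Θ ∪ Θ₀ zero) ∪ ΘR} ∘ inl {X = Θ ∪ Θ₀ zero} ∘ inl {X = Θ})
              (++⁺ˡ Γ (++⁺ˡ ΘR (inr {X = Θ}))))
         ,( ∪-least {X = Δ} (inl {X = Δ ∪ Σ₀ zero ∪ ΣR} ∘ inl {X = Δ})
              (∪-least {X = Σ₀ zero ∪ Σ}
                (∪-least {X = Σ₀ zero} (inl {X = Δ ∪ Σ₀ zero ∪ ΣR} ∘ inr {X = Δ} ∘ inl {X = Σ₀ zero})
                  (inr {X = Δ ∪ Σ₀ zero ∪ ΣR}))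
                (inl {X = Δ ∪ Σ₀ zero ∪ ΣR} ∘ inr {X = Δ} ∘ inr {X = Σ₀ zero}))
          , ∪-least {X = Δ ∪ Σ₀ zero ∪ ΣR} (++⁺ʳ Δ (++⁺ˡ ΣR (inl {X = Σ₀ zero})))
              (inr {X = Δ} ∘ inl {X = Σ₀ zero ∪ Σ} ∘ inr {X = Σ₀ zero})))
      (mix r Θ₁ Σ₁ ds₁)
    where
    ΘR ΣR : Atoms
    ΘR = ⋃ (Θ₀ ∘ suc)
    ΣR = ⋃ (Σ₀ ∘ suc)
    Θ₁ Σ₁ : Fin (length (S ∷ Ss)) → Atoms
    Θ₁ zero    = Θ ∪ Θ₀ zero
    Θ₁ (suc i) = Θ₀ (suc i)
    Σ₁ zero    = Σ₀ zero ∪ Σ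
    Σ₁ (suc i) = Σ₀ (suc i)
    ds₁ : ∀ i → ℬ ⊢ Θ₁ i ∪ ante (lookup (S ∷ Ss) i) ⇒ succ (lookup (S ∷ Ss) i) ∪ Σ₁ i
    ds₁ zero    = cong
      ( ( ∪-least {X = Θ} (inl {X = Θ ∪ Θ₀ zero} ∘ inl {X = Θ}) (++⁺ˡ (ante S) (inr {X = Θ}))
        , ∪-least {X = Θ ∪ Θ₀ zero} (++⁺ʳ Θ (inl {X = Θ₀ zero})) (inr {X = Θ} ∘ inr {X = Θ₀ zero}))
      , ( ∪-least {X = succ S ∪ Σ₀ zero} (++⁺ʳ (succ S) (inl {X = Σ₀ zero})) (inr {X = succ S} ∘ inr {X = Σ₀ zero})
        , ∪-least {X = succ S} (inl {X = succ S ∪ Σ₀ zero} ∘ inl {X = succ S}) (++⁺ˡ Σ (inr {X = succ S}))))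
      (add (ds zero) Θ Σ)
    ds₁ (suc i) = ds (suc i)
  add (cong ((f , f′) , (g , g′)) d) Θ Σ =
    cong ((++⁺ʳ Θ f , ++⁺ʳ Θ f′) , (++⁺ˡ Σ g , ++⁺ˡ Σ g′)) (add d Θ Σ)

  ⊢-ext : ∀ {S} → 𝒞 ⊇ ℬ → ℬ ⊢ S → 𝒞 ⊢ S
  ⊢-ext e (axiom r Θ Σ)  = axiom (e r) Θ Σ
  ⊢-ext e (mix r Θ Σ ds) = mix (e r) Θ Σ (λ i → ⊢-ext e (ds i))
  ⊢-ext e (cong eq d)    = cong eq (⊢-ext e d)

  Monotone : Meaning → Set₁
  Monotone K = ∀ {ℬ 𝒞 Θ Θ′} → 𝒞 ⊇ ℬ → Θ ⊆ Θ′ → K ℬ Θ → K 𝒞 Θ′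

  infix 3 _≤_
  _≤_ : Meaning → Meaning → Set₁
  K ≤ L = ∀ ℬ Θ → K ℬ Θ → L ℬ Θ

  derivable-mono : Monotone derivable
  derivable-mono {Θ = Θ} {Θ′} e s (lift d) =
    lift (cong (≈-refl , (∪-least {X = Θ} s id , inr {X = Θ})) (add (⊢-ext e d) [] Θ′))

  step-mono : ∀ A {K} → Monotone K → Monotone (step A K)
  step-mono (atom p) m e s k       = m e (∷⁺ʳ p s) k
  step-mono ⊥        m e s k       = m e s k
  step-mono (A ∧ B)  m e s (k , l) = step-mono A m e s k , step-mono B m e s l
  step-mono (A ∨ B)  m e s k       = step-mono A (step-mono B m) e s k
  step-mono (A ⟶ B)  m e s k 𝒟 e′ Θ a =
    step-mono B m id (++⁺ʳ Θ s) (k 𝒟 (λ r → e′ (e r)) Θ a)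

  supp-mono : ∀ Δ → Monotone (supp Δ)
  supp-mono []      = derivable-mono
  supp-mono (A ∷ Δ) = step-mono A (supp-mono Δ)

  step-≤ : ∀ A {K L} → K ≤ L → step A K ≤ step A L
  step-≤ (atom p) h ℬ Θ k       = h ℬ (p ∷ Θ) k
  step-≤ ⊥        h ℬ Θ k       = h ℬ Θ k
  step-≤ (A ∧ B)  h ℬ Θ (k , l) = step-≤ A h ℬ Θ k , step-≤ B h ℬ Θ l
  step-≤ (A ∨ B)  h ℬ Θ k       = step-≤ A (step-≤ B h) ℬ Θ k
  step-≤ (A ⟶ B)  h ℬ Θ k 𝒞 e Θ′ a = step-≤ B h 𝒞 (Θ′ ∪ Θ) (k 𝒞 e Θ′ a)

  step-add : ∀ A {K} → Monotone K → K ≤ step A K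
  step-add (atom p) m ℬ Θ k = m id (xs⊆x∷xs Θ p) k
  step-add ⊥        m ℬ Θ k = k
  step-add (A ∧ B)  m ℬ Θ k = step-add A m ℬ Θ k , step-add B m ℬ Θ k
  step-add (A ∨ B)  m ℬ Θ k = step-add A (step-mono B m) ℬ Θ (step-add B m ℬ Θ k)
  step-add (A ⟶ B)  m ℬ Θ k 𝒞 e Θ′ a = step-add B m 𝒞 (Θ′ ∪ Θ) (m e (inr {X = Θ′}) k)

  shift : Atoms → Meaning → Meaning
  shift Ψ K ℬ Θ = K ℬ (Ψ ∪ Θ)

  shift-mono : ∀ Ψ {K} → Monotone K → Monotone (shift Ψ K)
  shift-mono Ψ m e s = m e (++⁺ʳ Ψ s)

  step-shift : ∀ A Ψ {K} → Monotone K → shift Ψ (step A K) ≤ step A (shift Ψ K)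
  step-shift (atom p) Ψ m ℬ Θ k       = m id (⊆-swap (p ∷ []) Ψ) k
  step-shift ⊥        Ψ m ℬ Θ k       = k
  step-shift (A ∧ B)  Ψ m ℬ Θ (k , l) = step-shift A Ψ m ℬ Θ k , step-shift B Ψ m ℬ Θ l
  step-shift (A ∨ B)  Ψ m ℬ Θ k       =
    step-≤ A (step-shift B Ψ m) ℬ Θ (step-shift A Ψ (step-mono B m) ℬ Θ k)
  step-shift (A ⟶ B)  Ψ m ℬ Θ k 𝒞 e Θ′ a =
    step-shift B Ψ m 𝒞 (Θ′ ∪ Θ) (step-mono B m id (⊆-swap Θ′ Ψ) (k 𝒞 e Θ′ a))

  both : Meaning → Meaning → Meaning
  both K L ℬ Θ = K ℬ Θ × L ℬ Θ

  step-both : ∀ A {K L} → both (step A K) (step A L) ≤ step A (both K L)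
  step-both (atom p) ℬ Θ x = x
  step-both ⊥        ℬ Θ x = x
  step-both (A ∧ B)  ℬ Θ ((k , k′) , (l , l′)) = step-both A ℬ Θ (k , l) , step-both B ℬ Θ (k′ , l′)
  step-both (A ∨ B)  ℬ Θ x = step-≤ A (step-both B) ℬ Θ (step-both A ℬ Θ x)
  step-both (A ⟶ B)  ℬ Θ (k , l) 𝒞 e Θ′ a = step-both B 𝒞 (Θ′ ∪ Θ) (k 𝒞 e Θ′ a , l 𝒞 e Θ′ a)

  imp : Meaning → Meaning → Meaning
  imp P K ℬ Θ = ∀ 𝒞 → 𝒞 ⊇ ℬ → (Θ′ : Atoms) → P 𝒞 Θ′ → K 𝒞 (Θ′ ∪ Θ)

  imp-mono : ∀ P {K} → Monotone K → Monotone (imp P K)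
  imp-mono P m e s k 𝒟 e′ Θ a = m id (++⁺ʳ Θ s) (k 𝒟 (λ r → e′ (e r)) Θ a)

  step-imp : ∀ A P {K} → Monotone K → imp P (step A K) ≤ step A (imp P K)
  step-imp (atom p) P m ℬ Θ k 𝒞 e Θ′ a = m id (⊆-swap (p ∷ []) Θ′) (k 𝒞 e Θ′ a)
  step-imp ⊥        P m ℬ Θ k = k
  step-imp (A ∧ B)  P m ℬ Θ k =
    step-imp A P m ℬ Θ (λ 𝒞 e Θ′ a → proj₁ (k 𝒞 e Θ′ a)) ,
    step-imp B P m ℬ Θ (λ 𝒞 e Θ′ a → proj₂ (k 𝒞 e Θ′ a))
  step-imp (A ∨ B)  P m ℬ Θ k =
    step-≤ A (step-imp B P m) ℬ Θ (step-imp A P (step-mono B m) ℬ Θ k)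
  step-imp (A ⟶ B)  P m ℬ Θ k 𝒞 e Θ′ a =
    step-imp B P m 𝒞 (Θ′ ∪ Θ) λ 𝒟 e′ Θ″ b →
      step-mono B m id (⊆-swap Θ′ Θ″)
        (k 𝒟 (λ r → e′ (e r)) Θ″ b 𝒟 id Θ′ (step-mono A derivable-mono e′ id a))

  step-exch : ∀ A B {K} → Monotone K → step A (step B K) ≤ step B (step A K)
  step-exch (atom p) B m ℬ Θ k       = step-shift B (p ∷ []) m ℬ Θ k
  step-exch ⊥        B m ℬ Θ k       = k
  step-exch (A ∧ A′) B m ℬ Θ (k , l) =
    step-both B ℬ Θ (step-exch A B m ℬ Θ k , step-exch A′ B m ℬ Θ l)
  step-exch (A ∨ A′) B m ℬ Θ k       =
    step-exch A B (step-mono A′ m) ℬ Θ (step-≤ A (step-exch A′ B m) ℬ Θ k)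
  step-exch (A ⟶ A′) B m ℬ Θ k       =
    step-imp B (step A derivable) (step-mono A′ m) ℬ Θ
      (λ 𝒞 e Θ′ a → step-exch A′ B m 𝒞 (Θ′ ∪ Θ) (k 𝒞 e Θ′ a))

  step-contr : ∀ A {K} → Monotone K → step A (step A K) ≤ step A K
  step-contr (atom p) m ℬ Θ k       = m id (λ { (here e) → here e ; (there i) → i }) k
  step-contr ⊥        m ℬ Θ k       = k
  step-contr (A ∧ B)  m ℬ Θ (k , l) =
    step-contr A m ℬ Θ (step-≤ A (λ _ _ → proj₁) ℬ Θ k) ,
    step-contr B m ℬ Θ (step-≤ B (λ _ _ → proj₂) ℬ Θ l)
  step-contr (A ∨ B)  m ℬ Θ k       =
    step-≤ A (step-contr B m) ℬ Θ
      (step-contr A (step-mono B (step-mono B m)) ℬ Θ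
        (step-≤ A (step-exch B A (step-mono B m)) ℬ Θ k))
  step-contr (A ⟶ B) {K} m ℬ Θ k 𝒞 e Θ′ a =
    step-contr B m 𝒞 (Θ′ ∪ Θ)
      (step-mono B (step-mono B m) id (∪-least {X = Θ′} (inl {X = Θ′}) id)
        (step-exch B (A ⟶ B) m 𝒞 (Θ′ ∪ Θ) (k 𝒞 e Θ′ a) 𝒞 id Θ′ a))

  supp-absorb : ∀ {A Δ} → A ∈ Δ → step A (supp Δ) ≤ supp Δ
  supp-absorb {A} {_ ∷ Δ} (here refl) = step-contr A (supp-mono Δ)
  supp-absorb {A} {B ∷ Δ} (there i) ℬ Θ k =
    step-≤ B (supp-absorb i) ℬ Θ (step-exch A B (supp-mono Δ) ℬ Θ k)

  supp-[] : ∀ Δ → derivable ≤ supp Δ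
  supp-[] []      ℬ Θ k = k
  supp-[] (A ∷ Δ) ℬ Θ k = step-add A (supp-mono Δ) ℬ Θ (supp-[] Δ ℬ Θ k)

  supp-⊆ : ∀ {Δ Δ′} → Δ ⊆ Δ′ → supp Δ ≤ supp Δ′
  supp-⊆ {[]}    {Δ′} s ℬ Θ k = supp-[] Δ′ ℬ Θ k
  supp-⊆ {A ∷ Δ} {Δ′} s ℬ Θ k =
    supp-absorb (s (here refl)) ℬ Θ (step-≤ A (supp-⊆ (λ i → s (there i))) ℬ Θ k)

  supp-atoms⁻ : ∀ Ψ Δ → supp (atoms Ψ ∪ Δ) ≤ shift Ψ (supp Δ)
  supp-atoms⁻ []      Δ ℬ Θ k = k
  supp-atoms⁻ (p ∷ Ψ) Δ ℬ Θ k = supp-mono Δ id (⊆-swap Ψ (p ∷ [])) (supp-atoms⁻ Ψ Δ ℬ (p ∷ Θ) k)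

  supp-atoms⁺ : ∀ Ψ Δ → shift Ψ (supp Δ) ≤ supp (atoms Ψ ∪ Δ)
  supp-atoms⁺ []      Δ ℬ Θ k = k
  supp-atoms⁺ (p ∷ Ψ) Δ ℬ Θ k = supp-atoms⁺ Ψ Δ ℬ (p ∷ Θ) (supp-mono Δ id (⊆-swap (p ∷ []) Ψ) k)

  ++[] : {A : Set} {X : FinSet A} → X ∪ [] ⊆ X
  ++[] {X = X} = ∪-least {X = X} id λ ()

  ⊩At⁻ : ∀ ℬ Γ → ⊩[ ℬ ] atoms Γ → ℬ ⊢ [] ⇒ Γ
  ⊩At⁻ ℬ Γ k = lower (derivable-mono id ++[]
    (supp-atoms⁻ Γ [] ℬ [] (supp-⊆ (inl {X = atoms Γ}) ℬ [] k)))

  ⊩At⁺ : ∀ ℬ Γ → ℬ ⊢ [] ⇒ Γ → ⊩[ ℬ ] atoms Γ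
  ⊩At⁺ ℬ Γ d = supp-⊆ (++[] {X = atoms Γ}) ℬ []
    (supp-atoms⁺ Γ [] ℬ [] (derivable-mono id (inl {X = Γ}) (lift d)))

  index : ∀ {A} {Γ : Formulas} → A ∈ Γ → Fin (length Γ)
  index (here _)  = zero
  index (there m) = suc (index m)

  lookup-index : ∀ {A} {Γ : Formulas} (m : A ∈ Γ) → A ≡ lookup Γ (index m)
  lookup-index (here e)  = e
  lookup-index (there m) = lookup-index m

  lookup∈ : ∀ (Γ : Formulas) i → lookup Γ i ∈ Γ
  lookup∈ (A ∷ Γ) zero    = here refl
  lookup∈ (A ∷ Γ) (suc i) = there (lookup∈ Γ i)

  ⊆⋃ : ∀ {n} (X : Fin n → Atoms) i → X i ⊆ ⋃ X
  ⊆⋃ X zero    = inl {X = X zero}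
  ⊆⋃ X (suc i) = inr {X = X zero} ∘ ⊆⋃ (X ∘ suc) i

  ⋃-least : ∀ {n} (X : Fin n → Atoms) {Z} → (∀ i → X i ⊆ Z) → ⋃ X ⊆ Z
  ⋃-least {ℕ.zero}  X h ()
  ⋃-least {ℕ.suc n} X h = ∪-least {X = X zero} (h zero) (⋃-least (X ∘ suc) (h ∘ suc))

  Inf-⊆ : ∀ {ℬ A As B Bs Δ Δ′} → A ∷ As ⊆ B ∷ Bs → Δ ⊆ Δ′ →
          A ∷ As ⊩[ ℬ ] Δ → B ∷ Bs ⊩[ ℬ ] Δ′
  Inf-⊆ {ℬ} {A} {As} {B} {Bs} {Δ} {Δ′} s t k 𝒞 e Θ h =
    supp-atoms⁺ (⋃ Θ) Δ′ 𝒞 [] (supp-⊆ t 𝒞 (⋃ Θ ∪ [])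
      (supp-mono Δ id (++⁺ˡ [] (⋃-least (Θ ∘ ι) (λ i → ⊆⋃ Θ (ι i))))
        (supp-atoms⁻ (⋃ (Θ ∘ ι)) Δ 𝒞 [] (k 𝒞 e (Θ ∘ ι) λ i →
          subst (λ C → ⊩[ 𝒞 ] atoms (Θ (ι i)) ∪ (C ∷ [])) (sym (lookup-index (s (lookup∈ (A ∷ As) i)))) (h (ι i))))))
    where
    ι : Fin (length (A ∷ As)) → Fin (length (B ∷ Bs))
    ι i = index (s (lookup∈ (A ∷ As) i))

  absurd-∷ : {A : Set} {a : A} {X : FinSet A} {ℓ : Level} {P : Set ℓ} → a ∷ X ⊆ [] → P
  absurd-∷ s with s (here refl)
  ... | ()

  cong-⊩′ : ∀ {ℬ} Γ Γ′ {Δ Δ′} → Γ ≈ Γ′ → Δ ≈ Δ′ → Γ ⊩[ ℬ ] Δ → Γ′ ⊩[ ℬ ] Δ′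
  cong-⊩′ {ℬ} []      []      e f k = supp-⊆ (proj₁ f) ℬ [] k
  cong-⊩′     []      (_ ∷ _) e f k = absurd-∷ (proj₂ e)
  cong-⊩′     (_ ∷ _) []      e f k = absurd-∷ (proj₁ e)
  cong-⊩′ {ℬ} (_ ∷ _) (_ ∷ _) {Δ} e f k = Inf-⊆ {ℬ} {Δ = Δ} (proj₁ e) (proj₁ f) k

  ⊩⟶⁺ : ∀ ℬ A B Γ → ⊩[ ℬ ] ((A ⟶ B) ∷ Γ) → A ∷ [] ⊩[ ℬ ] B ∷ Γ
  ⊩⟶⁺ ℬ A B Γ k 𝒞 e Θ h =
    supp-atoms⁺ (⋃ Θ) (B ∷ Γ) 𝒞 [] (supp-mono (B ∷ Γ) id (++⁺ˡ [] (⊆⋃ Θ zero))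
      (k 𝒞 e (Θ zero) (supp-mono (A ∷ []) id ++[] (supp-atoms⁻ (Θ zero) (A ∷ []) 𝒞 [] (h zero)))))

  ⊩⟶⁻ : ∀ ℬ A B Γ → A ∷ [] ⊩[ ℬ ] B ∷ Γ → ⊩[ ℬ ] ((A ⟶ B) ∷ Γ)
  ⊩⟶⁻ ℬ A B Γ k 𝒞 e Θ a =
    supp-mono (B ∷ Γ) id (++⁺ˡ [] (++[] {X = Θ}))
      (supp-atoms⁻ (Θ ∪ []) (B ∷ Γ) 𝒞 []
        (k 𝒞 e (λ _ → Θ) λ { zero →
          supp-atoms⁺ Θ (A ∷ []) 𝒞 [] (supp-mono (A ∷ []) id (inl {X = Θ}) a) }))

supportClauses : SupportClauses _⊩[_]_
supportClauses = record
  { cong-⊩ = λ {_} {Γ} {Γ′} → cong-⊩′ Γ Γ′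
  ; ⊩At    = λ ℬ Γ → mk⇔ (⊩At⁻ ℬ Γ) (⊩At⁺ ℬ Γ)
  ; ⊩∧     = λ _ _ _ _ → mk⇔ id id
  ; ⊩∨     = λ _ _ _ _ → mk⇔ id id
  ; ⊩⟶     = λ ℬ A B Γ → mk⇔ (⊩⟶⁺ ℬ A B Γ) (⊩⟶⁻ ℬ A B Γ)
  ; ⊩⊥     = λ _ _ → mk⇔ id id
  ; Inf    = λ _ _ _ _ → mk⇔ id id
  }

module _ {_⊩⟨_⟩_ : Formulas → Base → Formulas → Set₁} (clauses : SupportClauses _⊩⟨_⟩_) where
  open SupportClauses clauses
  open Equivalence using (to; from)

  private
    Means : Meaning → Formulas → Set₁
    Means K Δ = ∀ ℬ Θ → ([] ⊩⟨ ℬ ⟩ (atoms Θ ∪ Δ)) ⇔ K ℬ Θ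

    re : ∀ {ℬ Δ Δ′} → Δ ≈ Δ′ → [] ⊩⟨ ℬ ⟩ Δ → [] ⊩⟨ ℬ ⟩ Δ′
    re = cong-⊩ ≈-refl

    front : ∀ X Y {Z : Formulas} → X ∪ Y ∪ Z ≈ Y ∪ X ∪ Z
    front X Y = ⊆-swap X Y , ⊆-swap Y X

    atoms-∪ : ∀ Ψ Θ {Z} → atoms (Ψ ∪ Θ) ∪ Z ≡ atoms Ψ ∪ atoms Θ ∪ Z
    atoms-∪ []      Θ = refl
    atoms-∪ (p ∷ Ψ) Θ {Z} rewrite atoms-∪ Ψ Θ {Z} = refl

    drop[] : ∀ Θ {Z} → atoms (Θ ∪ []) ∪ Z ≡ atoms Θ ∪ Z
    drop[] Θ {Z} = atoms-∪ Θ []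

    derivable-means : Means derivable []
    derivable-means ℬ Θ = mk⇔
      (λ k → lift (to (⊩At ℬ Θ) (re (++[] , inl {X = atoms Θ}) k)))
      (λ d → re (inl {X = atoms Θ} , ++[]) (from (⊩At ℬ Θ) (lower d)))

    step-means : ∀ A {K Δ} → Means K Δ → Means (step A K) (A ∷ Δ)
    step-means (atom p) {Δ = Δ} h ℬ Θ = mk⇔
      (λ k → to (h ℬ (p ∷ Θ)) (re (front (atoms Θ) (atom p ∷ [])) k))
      (λ k → re (front (atom p ∷ []) (atoms Θ)) (from (h ℬ (p ∷ Θ)) k))
    step-means ⊥ {Δ = Δ} h ℬ Θ = mk⇔
      (λ k → to (h ℬ Θ) (to (⊩⊥ ℬ _) (re (front (atoms Θ) (⊥ ∷ [])) k)))
      (λ k → re (front (⊥ ∷ []) (atoms Θ)) (from (⊩⊥ ℬ _) (from (h ℬ Θ) k)))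
    step-means (A ∧ B) {Δ = Δ} h ℬ Θ = mk⇔
      (λ k → let k₁ , k₂ = to (⊩∧ ℬ A B _) (re (front (atoms Θ) (A ∧ B ∷ [])) k) in
        to (step-means A h ℬ Θ) (re (front (A ∷ []) (atoms Θ)) k₁) ,
        to (step-means B h ℬ Θ) (re (front (B ∷ []) (atoms Θ)) k₂))
      (λ (k₁ , k₂) → re (front (A ∧ B ∷ []) (atoms Θ)) (from (⊩∧ ℬ A B _)
        ( re (front (atoms Θ) (A ∷ [])) (from (step-means A h ℬ Θ) k₁)
        , re (front (atoms Θ) (B ∷ [])) (from (step-means B h ℬ Θ) k₂))))
    step-means (A ∨ B) {Δ = Δ} h ℬ Θ = mk⇔
      (λ k → to (step-means A (step-means B h) ℬ Θ) (re (front (A ∷ B ∷ []) (atoms Θ))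
        (to (⊩∨ ℬ A B _) (re (front (atoms Θ) (A ∨ B ∷ [])) k))))
      (λ k → re (front (A ∨ B ∷ []) (atoms Θ)) (from (⊩∨ ℬ A B _)
        (re (front (atoms Θ) (A ∷ B ∷ [])) (from (step-means A (step-means B h) ℬ Θ) k))))
    step-means (A ⟶ B) {K} {Δ} h ℬ Θ = mk⇔ forth back
      where
      AB = (A ⟶ B) ∷ []
      forth : [] ⊩⟨ ℬ ⟩ (atoms Θ ∪ AB ∪ Δ) → step (A ⟶ B) K ℬ Θ
      forth k 𝒞 e Θ′ a = to (step-means B h 𝒞 (Θ′ ∪ Θ))
        (subst ([] ⊩⟨ 𝒞 ⟩_) (sym (atoms-∪ Θ′ Θ))
          (re (++⁺ʳ (atoms Θ′) (⊆-swap (B ∷ []) (atoms Θ)) , ++⁺ʳ (atoms Θ′) (⊆-swap (atoms Θ) (B ∷ [])))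
            (subst ([] ⊩⟨ 𝒞 ⟩_) (drop[] Θ′)
              (to (Inf ℬ A [] _) (to (⊩⟶ ℬ A B _) (re (front (atoms Θ) AB) k)) 𝒞 e (λ _ → Θ′)
                λ { zero → from (step-means A derivable-means 𝒞 Θ′) a }))))
      back : step (A ⟶ B) K ℬ Θ → [] ⊩⟨ ℬ ⟩ (atoms Θ ∪ AB ∪ Δ)
      back k = re (front AB (atoms Θ)) (from (⊩⟶ ℬ A B _) (from (Inf ℬ A [] _) λ 𝒞 e Θs a →
        subst ([] ⊩⟨ 𝒞 ⟩_) (sym (drop[] (Θs zero)))
          (re (++⁺ʳ (atoms (Θs zero)) (⊆-swap (atoms Θ) (B ∷ [])) , ++⁺ʳ (atoms (Θs zero)) (⊆-swap (B ∷ []) (atoms Θ)))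
            (subst ([] ⊩⟨ 𝒞 ⟩_) (atoms-∪ (Θs zero) Θ)
              (from (step-means B h 𝒞 (Θs zero ∪ Θ))
                (k 𝒞 e (Θs zero) (to (step-means A derivable-means 𝒞 (Θs zero)) (a zero))))))))

    supp-means : ∀ Δ → Means (supp Δ) Δ
    supp-means []      = derivable-means
    supp-means (A ∷ Δ) = step-means A (supp-means Δ)

  support-unique : ∀ ℬ Γ Δ → (Γ ⊩⟨ ℬ ⟩ Δ) ⇔ (Γ ⊩[ ℬ ] Δ)
  support-unique ℬ []       Δ = supp-means Δ ℬ []
  support-unique ℬ (A ∷ As) Δ = mk⇔ forth back
    where
    forth : (A ∷ As) ⊩⟨ ℬ ⟩ Δ → A ∷ As ⊩[ ℬ ] Δ
    forth k 𝒞 e Θ h = to (supp-means _ 𝒞 []) (to (Inf ℬ A As Δ) k 𝒞 e Θ (λ i → from (supp-means _ 𝒞 []) (h i)))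
    back : A ∷ As ⊩[ ℬ ] Δ → (A ∷ As) ⊩⟨ ℬ ⟩ Δ
    back k = from (Inf ℬ A As Δ) λ 𝒞 e Θ h →
      from (supp-means _ 𝒞 []) (k 𝒞 e Θ (λ i → to (supp-means _ 𝒞 []) (h i)))

{-# OPTIONS --safe #-}
module Submission where

open import Defs
open import Data.List.Base using ([]; _∷_)
open import Data.Product.Base using (_,_)
open import Function.Base using (id; _∘_)
open import Function.Bundles using (_⇔_; mk⇔)
open import Level using (lift)

-- `𝒮𝒯` is itself among the bases over which validity quantifies, and it is the least of them. The
-- theorem thus amounts to persistence of support: what a base supports, each of its extensions
-- supports (`⊩-extend`). Derivations survive the addition of rules, and the clauses for `⟶` and for
-- nonempty antecedents already range over all extensions.

private
  variable
    ℬ 𝒞 : Base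

⊢-extend : ∀ {S} → 𝒞 ⊇ ℬ → ℬ ⊢ S → 𝒞 ⊢ S
⊢-extend e (axiom r Θ Σ)  = axiom (e r) Θ Σ
⊢-extend e (mix r Θ Σ ds) = mix (e r) Θ Σ (λ i → ⊢-extend e (ds i))
⊢-extend e (cong eq d)    = cong eq (⊢-extend e d)

Persistent : Meaning → Set₁
Persistent K = ∀ {ℬ 𝒞 Θ} → 𝒞 ⊇ ℬ → K ℬ Θ → K 𝒞 Θ

derivable-persistent : Persistent derivable
derivable-persistent e (lift d) = lift (⊢-extend e d)

-- Induction on `A` with `K` arbitrary: the case of `A ∨ B` applies the hypothesis for `A` to the
-- meaning `step B K`.
step-persistent : ∀ A {K} → Persistent K → Persistent (step A K)
step-persistent (atom p) m e k       = m e k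
step-persistent ⊥        m e k       = m e k
step-persistent (A ∧ B)  m e (k , l) = step-persistent A m e k , step-persistent B m e l
step-persistent (A ∨ B)  m e k       = step-persistent A (step-persistent B m) e k
step-persistent (A ⟶ B)  m e k 𝒟 e′  = k 𝒟 (e′ ∘ e)

supp-persistent : ∀ Δ → Persistent (supp Δ)
supp-persistent []      = derivable-persistent
supp-persistent (A ∷ Δ) = step-persistent A (supp-persistent Δ)

⊩-extend : ∀ Γ Δ → 𝒞 ⊇ ℬ → Γ ⊩[ ℬ ] Δ → Γ ⊩[ 𝒞 ] Δ
⊩-extend []      Δ e k       = supp-persistent Δ e k
-- By transitivity of `⊇`, an extension `𝒟` of `𝒞` is one of the extensions of `ℬ` that `k` covers.
⊩-extend (_ ∷ _) Δ e k 𝒟 e′  = k 𝒟 (e′ ∘ e)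

theorem1 : (Γ Δ : Formulas) → (Γ ⊩ Δ) ⇔ (Γ ⊩[ 𝒮𝒯 ] Δ)
theorem1 Γ Δ = mk⇔ restrict extend
  where
  restrict : Γ ⊩ Δ → Γ ⊩[ 𝒮𝒯 ] Δ
  restrict k = k 𝒮𝒯 id

  extend : Γ ⊩[ 𝒮𝒯 ] Δ → Γ ⊩ Δ
  extend k ℬ e = ⊩-extend Γ Δ e k
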